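{- For every positive integer $N$, there exists a (finite simple) graph $G$ such that $fxd(G)-fix(G)\ge N$.
   Context: For a graph $G$, a set $D\subseteq V(G)$ is a fixing set of $G$ if the only automorphism of $G$ that fixes every vertex of $D$ is the identity. The fixing number $fix(G)$ is the minimum cardinality of a fixing set of $G$. The fixed number $fxd(G)$ is the minimum number $k$ such that every subset of $V(G)$ of cardinality $k$ is a fixing set of $G$. -}

module Defs where

open import Data.Fin.Base using (Fin)
open import Data.Fin.Permutation using (Permutation′; _⟨$⟩ʳ_; _≈_; id)
open import Data.Fin.Subset using (Subset; _∈_; ∣_∣)
open import Data.Nat.Base using (ℕ; _≤_)
open import Data.Nat.Properties using (≤-antisym)
open import Data.Product.Base using (_×_; _,_; ∃-syntax)
open import Function.Bundles using (_⇔_)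
open import Relation.Binary.Definitions using (Decidable; Irreflexive; Symmetric)
open import Relation.Binary.PropositionalEquality.Core using (_≡_)

-- Decidability of adjacency is automatic classically for a finite graph.
record Graph (n : ℕ) : Set₁ where
  field
    _~_      : Fin n → Fin n → Set
    ~-dec    : Decidable _~_
    ~-sym    : Symmetric _~_
    ~-irrefl : Irreflexive _≡_ _~_

IsAutomorphism : ∀ {n} → Graph n → Permutation′ n → Set
IsAutomorphism G π = ∀ u v → (u ~ v) ⇔ ((π ⟨$⟩ʳ u) ~ (π ⟨$⟩ʳ v))
  where open Graph G

-- Equality with the identity is pointwise (_≈_): the stdlib type of
-- permutations is not extensional.
IsFixingSet : ∀ {n} → Graph n → Subset n → Set
IsFixingSet {n} G D =
  ∀ (π : Permutation′ n) → IsAutomorphism G π →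
  (∀ {v} → v ∈ D → π ⟨$⟩ʳ v ≡ v) → π ≈ id

IsMinimum : (ℕ → Set) → ℕ → Set
IsMinimum P k = P k × (∀ j → P j → k ≤ j)

-- Minima are given as relations; by this lemma a graph has at most one
-- fixing number and at most one fixed number.
IsMinimum-unique : ∀ {P k l} → IsMinimum P k → IsMinimum P l → k ≡ l
IsMinimum-unique (Pk , k≤) (Pl , l≤) = ≤-antisym (k≤ _ Pl) (l≤ _ Pk)

IsFixingNumber : ∀ {n} → Graph n → ℕ → Set
IsFixingNumber G =
  IsMinimum (λ k → ∃[ D ] (∣ D ∣ ≡ k × IsFixingSet G D))

-- The condition holds vacuously for k > n, but this never affects the
-- minimum: it already holds at k = n, where the only subset is V(G).
IsFixedNumber : ∀ {n} → Graph n → ℕ → Set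
IsFixedNumber {n} G =
  IsMinimum (λ k → ∀ (D : Subset n) → ∣ D ∣ ≡ k → IsFixingSet G D)

{-# OPTIONS --safe #-}
-- The perfect matching on 2(N+1) vertices works.  Swapping the ends of one
-- edge is an automorphism, so a fixing set meets every edge; conversely one
-- end of each edge suffices, since the other end is its only neighbour.  Hence
-- fix = N+1.  A set missing just one vertex is always fixing, while smaller
-- sizes allow a set to miss a whole edge, hence fxd = 2N+1.
module Submission where

open import Defs
open import Data.Nat.Base using (ℕ; _∸_; _<_; _≥_)
open import Data.Product.Base using (_×_; Σ-syntax)

open import Data.Fin.Base using (Fin; zero; suc)
open import Data.Fin.Permutation using (Permutation′; _⟨$⟩ʳ_; transpose)
open import Data.Fin.Properties using (_≟_; suc-injective)
open import Data.Fin.Subset using (Subset; inside; outside; _∈_; _∉_; ∣_∣; ⊤; ⊥; _-_)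
open import Data.Fin.Subset.Properties
  using (_∈?_; drop-there; ∈⊤; ∣⊤∣≡n; ∣⊥∣≡0; p⊆q⇒∣p∣≤∣q∣; x∈p⇒∣p-x∣<∣p∣; x∈p∧x≢y⇒x∈p-y)
open import Data.Nat.Base using (zero; suc; _+_; _≤_; z≤n; s≤s)
open import Data.Nat.Properties
  using (≤-reflexive; ≤-trans; n≮n; m≤n⇒m≤1+n; ≰⇒>; m+n∸n≡m; +-suc)
open import Data.Product.Base using (_,_)
open import Data.Sum.Base using (_⊎_; inj₁; inj₂)
import Data.Sum.Base as Sum
open import Data.Vec.Base using ([]; _∷_; here; there)
open import Function.Base using (_∘_; case_of_)
open import Function.Bundles using (Injection; mk⇔; Equivalence)
open import Function.Properties.Inverse using (↔⇒↣)
open import Relation.Binary.PropositionalEquality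
  using (_≡_; _≢_; refl; sym; trans; cong; subst)
open import Relation.Nullary using (Dec; yes; no; contradiction)
open import Relation.Nullary.Decidable using (dec-true; dec-false)

private
  variable
    n : ℕ

⟨$⟩ʳ-injective : (π : Permutation′ n) {u v : Fin n} → π ⟨$⟩ʳ u ≡ π ⟨$⟩ʳ v → u ≡ v
⟨$⟩ʳ-injective π = Injection.injective (↔⇒↣ π)

transpose-left : (i j : Fin n) → transpose i j ⟨$⟩ʳ i ≡ j
transpose-left i j rewrite dec-true (i ≟ i) refl = refl

transpose-right : (i j : Fin n) → transpose i j ⟨$⟩ʳ j ≡ i
transpose-right i j with j ≟ i
... | yes j≡i = j≡i
... | no  _ rewrite dec-true (j ≟ j) refl = refl

transpose-other : {i j k : Fin n} → k ≢ i → k ≢ j → transpose i j ⟨$⟩ʳ k ≡ k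
transpose-other {i = i} {j} {k} k≢i k≢j
  rewrite dec-false (k ≟ i) k≢i | dec-false (k ≟ j) k≢j = refl

-- `p` lies inside the full set with `u` and `v` deleted, and each deletion strictly lowers the
-- cardinality.
two-outside⇒2+∣p∣≤n : {p : Subset n} {u v : Fin n} →
                      u ≢ v → u ∉ p → v ∉ p → 2 + ∣ p ∣ ≤ n
two-outside⇒2+∣p∣≤n {n} {p} {u} {v} u≢v u∉p v∉p =
  subst (2 + ∣ p ∣ ≤_) (∣⊤∣≡n n)
    (≤-trans (s≤s (≤-trans (s≤s (p⊆q⇒∣p∣≤∣q∣ p⊆⊤-u-v))
                           (x∈p⇒∣p-x∣<∣p∣ (x∈p∧x≢y⇒x∈p-y ∈⊤ (u≢v ∘ sym)))))
             (x∈p⇒∣p-x∣<∣p∣ (∈⊤ {x = u})))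
  where
  p⊆⊤-u-v : ∀ {x} → x ∈ p → x ∈ ⊤ - u - v
  p⊆⊤-u-v x∈p =
    x∈p∧x≢y⇒x∈p-y (x∈p∧x≢y⇒x∈p-y ∈⊤ λ { refl → u∉p x∈p }) λ { refl → v∉p x∈p }

-- A moved vertex `u` is outside `D`, and so is its image: were the image fixed, injectivity would
-- make `u` fixed too. Hence a nontrivial permutation fixing `D` pointwise needs two vertices
-- outside `D`.
n≤1+∣D∣⇒fixing : (G : Graph n) (D : Subset n) → n ≤ 1 + ∣ D ∣ → IsFixingSet G D
n≤1+∣D∣⇒fixing G D n≤1+∣D∣ π _ fixesD u with π ⟨$⟩ʳ u ≟ u
... | yes πu≡u = πu≡u
... | no  πu≢u = contradiction (≤-trans (two-outside⇒2+∣p∣≤n πu≢u πu∉D u∉D) n≤1+∣D∣) (n≮n _)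
  where
  u∉D : u ∉ D
  u∉D = πu≢u ∘ fixesD

  πu∉D : π ⟨$⟩ʳ u ∉ D
  πu∉D = πu≢u ∘ ⟨$⟩ʳ-injective π ∘ fixesD

subset-of-size : ∀ {j} → j ≤ n → Σ[ p ∈ Subset n ] ∣ p ∣ ≡ j
subset-of-size {n}     z≤n       = ⊥ , ∣⊥∣≡0 n
subset-of-size {suc _} (s≤s j≤n) =
  let p , ∣p∣≡j = subset-of-size j≤n in inside ∷ p , cong suc ∣p∣≡j

-- Unlike n + n, this reduces to two constructors at a successor.
double : ℕ → ℕ
double zero    = zero
double (suc n) = suc (suc (double n))

double∸n≡n : ∀ n → double n ∸ n ≡ n
double∸n≡n n = trans (cong (_∸ n) (double≡n+n n)) (m+n∸n≡m n n)
  where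
  double≡n+n : ∀ n → double n ≡ n + n
  double≡n+n zero    = refl
  double≡n+n (suc n) = cong suc (trans (cong suc (double≡n+n n)) (sym (+-suc n n)))

-- The fixed-point-free involution exchanging 2k and 2k+1; its orbits are the edges of the matching.
mate : Fin (double n) → Fin (double n)
mate {suc _} zero          = suc zero
mate {suc _} (suc zero)    = zero
mate {suc n} (suc (suc i)) = suc (suc (mate {n} i))

mate-involutive : (i : Fin (double n)) → mate {n} (mate {n} i) ≡ i
mate-involutive {suc _} zero          = refl
mate-involutive {suc _} (suc zero)    = refl
mate-involutive {suc n} (suc (suc i)) = cong (λ j → suc (suc j)) (mate-involutive {n} i)

mate-irrefl : (i : Fin (double n)) → mate {n} i ≢ i
mate-irrefl {suc n} (suc (suc i)) eq = mate-irrefl {n} i (suc-injective (suc-injective eq))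

mate-swap : {u v : Fin (double n)} → mate {n} u ≡ v → mate {n} v ≡ u
mate-swap {n} {u} refl = mate-involutive {n} u

matching : ∀ n → Graph (double n)
matching n = record
  { _~_      = λ u v → mate {n} u ≡ v
  ; ~-dec    = λ u v → mate {n} u ≟ v
  ; ~-sym    = mate-swap {n}
  ; ~-irrefl = λ { {u} refl → mate-irrefl {n} u }
  }

commutes⇒automorphism : (π : Permutation′ (double n)) →
  (∀ u → mate {n} (π ⟨$⟩ʳ u) ≡ π ⟨$⟩ʳ mate {n} u) → IsAutomorphism (matching n) π
commutes⇒automorphism π commutes u v = mk⇔
  (λ u~v → trans (commutes u) (cong (π ⟨$⟩ʳ_) u~v))
  (λ πu~πv → ⟨$⟩ʳ-injective π (trans (sym (commutes u)) πu~πv))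

edge-swap : Fin (double n) → Permutation′ (double n)
edge-swap {n} i = transpose i (mate {n} i)

edge-swap-automorphism : (i : Fin (double n)) → IsAutomorphism (matching n) (edge-swap {n} i)
edge-swap-automorphism {n} i = commutes⇒automorphism {n} (edge-swap {n} i) commutes
  where
  commutes : ∀ u → mate {n} (edge-swap {n} i ⟨$⟩ʳ u) ≡ edge-swap {n} i ⟨$⟩ʳ mate {n} u
  commutes u = by-cases (u ≟ i) (u ≟ mate {n} i)
    where
    by-cases : Dec (u ≡ i) → Dec (u ≡ mate {n} i) →
               mate {n} (edge-swap {n} i ⟨$⟩ʳ u) ≡ edge-swap {n} i ⟨$⟩ʳ mate {n} u
    by-cases (yes refl) _ =
      trans (cong (mate {n}) (transpose-left u (mate {n} u)))
        (trans (mate-involutive {n} u) (sym (transpose-right u (mate {n} u))))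
    by-cases (no _) (yes refl) =
      trans (cong (mate {n}) (transpose-right i (mate {n} i)))
        (sym (trans (cong (edge-swap {n} i ⟨$⟩ʳ_) (mate-involutive {n} i))
                    (transpose-left i (mate {n} i))))
    by-cases (no u≢i) (no u≢mi) =
      trans (cong (mate {n}) (transpose-other u≢i u≢mi))
        -- Off the edge, `mate` stays off the edge: if `mate u` were one of its ends, involutivity
        -- would make `u` the other.
        (sym (transpose-other
          (u≢mi ∘ sym ∘ mate-swap {n})
          (λ mu≡mi → u≢i (trans (sym (mate-swap {n} mu≡mi)) (mate-involutive {n} i)))))

MeetsEveryEdge : ∀ n → Subset (double n) → Set
MeetsEveryEdge n D = ∀ i → i ∈ D ⊎ mate {n} i ∈ D

-- Swapping the ends of a missed edge would fix `D` pointwise and still move `i`.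
fixing⇒meets : (D : Subset (double n)) → IsFixingSet (matching n) D → MeetsEveryEdge n D
fixing⇒meets {n} D fixing i with i ∈? D | mate {n} i ∈? D
... | yes i∈D | _        = inj₁ i∈D
... | no _    | yes mi∈D = inj₂ mi∈D
... | no i∉D  | no mi∉D  = contradiction
  (trans (sym (transpose-left i (mate {n} i)))
         (fixing (edge-swap {n} i) (edge-swap-automorphism {n} i) fixesD i))
  (mate-irrefl {n} i)
  where
  fixesD : ∀ {v} → v ∈ D → edge-swap {n} i ⟨$⟩ʳ v ≡ v
  fixesD v∈D = transpose-other (λ { refl → i∉D v∈D }) (λ { refl → mi∉D v∈D })

meets⇒fixing : (D : Subset (double n)) → MeetsEveryEdge n D → IsFixingSet (matching n) D
meets⇒fixing {n} D meets π auto fixesD i with meets i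
... | inj₁ i∈D  = fixesD i∈D
... | inj₂ mi∈D =
  -- The image of `i` is adjacent to the image of `mate i`, which is `mate i` itself, and the only
  -- neighbour of `mate i` is `i`.
  trans (sym (Equivalence.to (auto (mate {n} i) i) (mate-involutive {n} i)))
    (trans (cong (mate {n}) (fixesD mi∈D)) (mate-involutive {n} i))

-- The ends of an edge are consecutive, so induction peels off two entries at a time, at least one
-- of them `inside`.
meets⇒n≤∣D∣ : (D : Subset (double n)) → MeetsEveryEdge n D → n ≤ ∣ D ∣
meets⇒n≤∣D∣ {zero}  _           _     = z≤n
meets⇒n≤∣D∣ {suc n} (x ∷ y ∷ D) meets = count x y (meets zero) (meets⇒n≤∣D∣ D meetsD)
  where
  meetsD : MeetsEveryEdge n D
  meetsD i = Sum.map (drop-there ∘ drop-there) (drop-there ∘ drop-there) (meets (suc (suc i)))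

  count : ∀ x y → zero ∈ x ∷ y ∷ D ⊎ suc zero ∈ x ∷ y ∷ D → n ≤ ∣ D ∣ → suc n ≤ ∣ x ∷ y ∷ D ∣
  count inside  inside  _                   n≤∣D∣ = s≤s (m≤n⇒m≤1+n n≤∣D∣)
  count inside  outside _                   n≤∣D∣ = s≤s n≤∣D∣
  count outside inside  _                   n≤∣D∣ = s≤s n≤∣D∣
  count outside outside (inj₂ (there ()))

transversal : ∀ n → Subset (double n)
transversal zero    = []
transversal (suc n) = inside ∷ outside ∷ transversal n

∣transversal∣≡n : ∀ n → ∣ transversal n ∣ ≡ n
∣transversal∣≡n zero    = refl
∣transversal∣≡n (suc n) = cong suc (∣transversal∣≡n n)

transversal-meets : ∀ n → MeetsEveryEdge n (transversal n)
transversal-meets (suc n) zero          = inj₁ here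
transversal-meets (suc n) (suc zero)    = inj₂ here
transversal-meets (suc n) (suc (suc i)) =
  Sum.map (there ∘ there) (there ∘ there) (transversal-meets n i)

matching-fixingNumber : ∀ n → IsFixingNumber (matching n) n
matching-fixingNumber n =
  (transversal n , ∣transversal∣≡n n , meets⇒fixing {n} _ (transversal-meets n)) ,
  λ { _ (D , refl , fixing) → meets⇒n≤∣D∣ D (fixing⇒meets {n} D fixing) }

-- A set of this size misses exactly one vertex, so it is fixing. Any size up to `double n` is
-- realised by a set that avoids the first edge.
matching-fixedNumber : ∀ n → IsFixedNumber (matching (suc n)) (suc (double n))
matching-fixedNumber n =
  (λ D ∣D∣≡ → n≤1+∣D∣⇒fixing (matching (suc n)) D (≤-reflexive (cong suc (sym ∣D∣≡)))) ,
  λ j fixing → ≰⇒> λ j≤double →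
    let p , ∣p∣≡j = subset-of-size j≤double
        -- `p` lives on the remaining `double n` vertices, so `D` has size `j` and misses both ends
        -- of the first edge.
        D = outside ∷ outside ∷ p
    in case fixing⇒meets {suc n} D (fixing D ∣p∣≡j) zero of λ { (inj₂ (there ())) }

theorem4p1 : ∀ (N : ℕ) → 0 < N →
    Σ[ n ∈ ℕ ] Σ[ G ∈ Graph n ] Σ[ fix ∈ ℕ ] Σ[ fxd ∈ ℕ ]
    (IsFixingNumber G fix × IsFixedNumber G fxd × fxd ∸ fix ≥ N)
theorem4p1 N _ =
  -- With N+1 edges the difference is (2N+1) - (N+1), which reduces to `double N ∸ N`, that is,
  -- exactly `N`.
  double (suc N) , matching (suc N) , suc N , suc (double N) ,
  matching-fixingNumber (suc N) , matching-fixedNumber N , ≤-reflexive (sym (double∸n≡n N))
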